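{- Let $n\ge1$ and $u\in\mathfrak{S}_n$. The Hopf algebra morphism $\mathcal{D}\colon\mathfrak{S}Sym\to QSym$, $\mathcal{F}_u\mapsto F_{\mathrm{Des}(u)}$, satisfies $$\mathcal{D}(\mathcal{M}_u)=\begin{cases}M_{\mathrm{GDes}(u)}&\text{if }u\text{ is closed},\\ 0&\text{otherwise.}\end{cases}$$
   Context: Permutations in one-line notation. $\mathrm{Des}(u)=\{p\in[n-1]:u_p>u_{p+1}\}$, $\mathrm{GDes}(u)=\{p\in[n-1]:u_i>u_j\text{ for all }i\le p<j\}$. For $J=\{p_1<\cdots<p_k\}\subseteq[n-1]$, $\zeta_J=(n{ - }p_1{+}1,\ldots,n,\ n{ - }p_2{+}1,\ldots,n{ - }p_1,\ldots,1,\ldots,n{ - }p_k)$, $\zeta_\emptyset=1_n$. A permutation $u\in\mathfrak{S}_n$ is closed if $u=\zeta_J$ for some $J\subseteq[n-1]$ (equivalently $\mathrm{Des}(u)=\mathrm{GDes}(u)$). $\mathfrak{S}Sym$ has basis $\{\mathcal{F}_u\}$; with the weak order ($u\le v$ iff $\mathrm{Inv}(u)\subseteq\mathrm{Inv}(v)$, $\mathrm{Inv}(u)=\{(i,j):i<j,u_i>u_j\}$) and its Möbius function $\mu$, $\mathcal{M}_u=\sum_{v\ge u}\mu(u,v)\mathcal{F}_v$. $QSym$ is the algebra of quasi-symmetric functions in commuting variables $x_1,x_2,\ldots$; for $J=\{j_1<\cdots<j_{k-1}\}\subseteq[n-1]$ with associated composition $\alpha=(j_1,j_2-j_1,\ldots,n-j_{k-1})$,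 the monomial quasi-symmetric function is $M_J=M_{J,n}=\sum_{i_1<\cdots<i_k}x_{i_1}^{\alpha_1}\cdots x_{i_k}^{\alpha_k}$ and the fundamental one is $F_J=\sum_{K\supseteq J,\,K\subseteq[n-1]}M_K$. The map $\mathcal{D}$ is (known to be) a morphism of Hopf algebras. -}

module Defs where

open import Data.Bool.Base using (true; false; if_then_else_)
open import Data.Fin.Base as Fin using (Fin; zero; suc; toℕ; inject₁)
import Data.Fin.Properties as Fin
open import Data.Fin.Permutation as Perm using (Permutation′; _⟨$⟩ʳ_; _⟨$⟩ˡ_; insert; remove; insert-remove; inverseˡ; inverseʳ)
open import Data.Fin.Subset using (Subset; inside; outside)
open import Data.Fin.Subset.Properties using (_∈?_; _⊆?_)
open import Data.Integer.Base as ℤ using (ℤ; 0ℤ; 1ℤ)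
import Data.Integer.Properties as ℤ
open import Data.List.Base as List using (List; []; _∷_; _++_; map; filter; foldr; length; upTo; allFin; concatMap; cartesianProduct)
import Data.List.Properties as List
open import Data.List.Membership.Propositional using (_∈_)
import Data.List.Membership.Propositional.Properties as ∈
open import Data.List.Relation.Unary.All as All using (All)
open import Data.List.Relation.Unary.AllPairs as AllPairs using (AllPairs; []; _∷_)
import Data.List.Relation.Unary.AllPairs.Properties as AllPairs
import Data.List.Relation.Unary.All.Properties as All
open import Data.List.Relation.Unary.Any as Any using (Any; here; there)
import Data.List.Relation.Unary.Any.Properties as Any
open import Data.List.Relation.Unary.Linked using (Linked)
import Data.List.Relation.Unary.Unique.Propositional.Properties as Unique
open import Data.Nat.Base as ℕ using (ℕ; zero; suc; pred; _∸_; z≤n; s≤s)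
import Data.Nat.Properties as ℕ
open import Data.Nat.Induction using (<-wellFounded)
open import Data.Nat.ListAction using (sum)
open import Data.Product.Base using (Σ; ∃; _×_; _,_; proj₁; proj₂)
open import Data.Rational.Base as ℚ using (ℚ; 0ℚ; 1ℚ; -_)
import Data.Rational.Properties as ℚ
open import Data.Vec.Base as Vec using ([]; _∷_)
import Data.Vec.Properties as Vec
open import Function.Base using (_∘_; _on_)
open import Induction.WellFounded using (Acc; acc; WellFounded; module Subrelation)
open import Relation.Binary.Construct.On as On using ()
open import Relation.Binary.Definitions using (Decidable; tri<; tri≈; tri>)
open import Relation.Binary.PropositionalEquality using (_≡_; _≢_; refl; sym; trans; cong; cong₂; subst; module ≡-Reasoning)
open import Relation.Nullary using (¬_; Dec; yes; no; does; contradiction)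
open import Relation.Nullary.Decidable as Dec using (_×-dec_; _→-dec_; ¬?; dec-true; dec-false)
import Relation.Unary as U

private
  variable
    n : ℕ

-- Permutations.  S_n is Permutation′ n; positions and values are
-- 0-based in Fin n.

oneLine : Permutation′ n → List ℕ
oneLine u = List.tabulate (λ i → suc (toℕ (u ⟨$⟩ʳ i)))

-- The element k of Fin (n - 1) stands for p = k + 1 in [n - 1], so that
-- u_p and u_{p+1} sit at the indices inject₁ k and suc k.  For n = 0 the
-- set [n - 1] is empty.

IsDescent : Permutation′ (suc n) → Fin n → Set
IsDescent u k = u ⟨$⟩ʳ suc k Fin.< u ⟨$⟩ʳ inject₁ k

IsGlobalDescent : Permutation′ (suc n) → Fin n → Set
IsGlobalDescent u k = ∀ i j → i Fin.≤ inject₁ k → inject₁ k Fin.< j → u ⟨$⟩ʳ j Fin.< u ⟨$⟩ʳ i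

isDescent? : (u : Permutation′ (suc n)) (k : Fin n) → Dec (IsDescent u k)
isDescent? u k = u ⟨$⟩ʳ suc k Fin.<? u ⟨$⟩ʳ inject₁ k

isGlobalDescent? : (u : Permutation′ (suc n)) (k : Fin n) → Dec (IsGlobalDescent u k)
isGlobalDescent? u k = Fin.all? λ i → Fin.all? λ j →
  (i Fin.≤? inject₁ k) →-dec ((inject₁ k Fin.<? j) →-dec (u ⟨$⟩ʳ j Fin.<? u ⟨$⟩ʳ i))

Des : Permutation′ n → Subset (pred n)
Des {zero}  u = []
Des {suc n} u = Vec.tabulate (λ k → does (isDescent? u k))

GDes : Permutation′ n → Subset (pred n)
GDes {zero}  u = []
GDes {suc n} u = Vec.tabulate (λ k → does (isGlobalDescent? u k))

-- J = {p₁ < ⋯ < pₖ} ⊆ [n - 1], as an increasing list of 1-based numbers.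
elements : Subset n → List ℕ
elements {n} J = map (suc ∘ toℕ) (filter (_∈? J) (allFin n))

[_⋯_] : ℕ → ℕ → List ℕ
[ a ⋯ b ] = map (a ℕ.+_) (upTo (suc b ∸ a))

-- The part of the one-line notation of ζ_J that follows the position q,
-- for q in J or q = 0; ps are the elements of J above q.
blocks : ℕ → ℕ → List ℕ → List ℕ
blocks n q []       = [ 1 ⋯ n ∸ q ]
blocks n q (p ∷ ps) = [ n ∸ p ℕ.+ 1 ⋯ n ∸ q ] ++ blocks n p ps

ζ : ∀ n → Subset (pred n) → List ℕ
ζ n J = blocks n 0 (elements J)

Closed : Permutation′ n → Set
Closed {n} u = ∃ λ (J : Subset (pred n)) → oneLine u ≡ ζ n J

perms : ∀ n → List (Permutation′ n)
perms zero    = Perm.id ∷ []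
perms (suc n) = concatMap (λ j → map (insert zero j) (perms n)) (allFin (suc n))

insert₀-cong : ∀ j {u v : Permutation′ n} → u Perm.≈ v → insert zero j u Perm.≈ insert zero j v
insert₀-cong j u≈v zero    = refl
insert₀-cong j u≈v (suc i) = cong (Fin.punchIn j) (u≈v i)

perms-complete : (u : Permutation′ n) → Any (u Perm.≈_) (perms n)
perms-complete {zero}  u = here (λ ())
perms-complete {suc n} u = Any.concatMap⁺ _ (Any.map step (∈.∈-allFin (u ⟨$⟩ʳ zero)))
  where
  step : ∀ {j} → u ⟨$⟩ʳ zero ≡ j → Any (u Perm.≈_) (map (insert zero j) (perms n))
  step refl = Any.map⁺ (Any.map
    (λ {v} r≈v i → trans (sym (insert-remove zero u i)) (insert₀-cong (u ⟨$⟩ʳ zero) {remove zero u} {v} r≈v i))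
    (perms-complete (remove zero u)))

perms-unique : ∀ n → AllPairs (λ u v → ¬ u Perm.≈ v) (perms n)
perms-unique zero    = All.[] ∷ []
perms-unique (suc n) = AllPairs.concat⁺
  (All.map⁺ (All.universal (λ j → AllPairs.map⁺ (AllPairs.map (λ {u} {v} → inner j u v) (perms-unique n))) _))
  (AllPairs.map⁺ (AllPairs.map outer (Unique.allFin⁺ (suc n))))
  where
  inner : ∀ j (u v : Permutation′ n) → ¬ u Perm.≈ v → ¬ insert zero j u Perm.≈ insert zero j v
  inner j u v u≉v eq = u≉v λ i → Fin.punchIn-injective j _ _ (eq (suc i))

  outer : ∀ {j k} → j ≢ k → All (λ u → All (λ v → ¬ u Perm.≈ v) (map (insert zero k) (perms n))) (map (insert zero j) (perms n))
  outer j≢k = All.map⁺ (All.universal (λ _ → All.map⁺ (All.universal (λ _ eq → j≢k (eq zero)) _)) _)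

Inv : Permutation′ n → Fin n × Fin n → Set
Inv u (i , j) = i Fin.< j × u ⟨$⟩ʳ j Fin.< u ⟨$⟩ʳ i

infix 4 _≼_ _≺_ _≼?_ _≺?_ _≈?_

_≼_ : Permutation′ n → Permutation′ n → Set
u ≼ v = Inv u U.⊆ Inv v

_≺_ : Permutation′ n → Permutation′ n → Set
u ≺ v = u ≼ v × ¬ u Perm.≈ v

_≈?_ : Decidable (Perm._≈_ {n} {n})
u ≈? v = Fin.all? λ i → u ⟨$⟩ʳ i Fin.≟ v ⟨$⟩ʳ i

Inv? : (u : Permutation′ n) → U.Decidable (Inv u)
Inv? u (i , j) = (i Fin.<? j) ×-dec (u ⟨$⟩ʳ j Fin.<? u ⟨$⟩ʳ i)

_≼?_ : Decidable (_≼_ {n})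
u ≼? v = Dec.map′ (λ f {(i , j)} → f i j) (λ f i j → f {i , j})
  (Fin.all? λ i → Fin.all? λ j → Inv? u (i , j) →-dec Inv? v (i , j))

_≺?_ : Decidable (_≺_ {n})
u ≺? v = (u ≼? v) ×-dec ¬? (u ≈? v)

private
  ⟨$⟩ʳ-injective : (u : Permutation′ n) → ∀ {i j} → u ⟨$⟩ʳ i ≡ u ⟨$⟩ʳ j → i ≡ j
  ⟨$⟩ʳ-injective u eq = trans (sym (inverseˡ u)) (trans (cong (u ⟨$⟩ˡ_) eq) (inverseˡ u))

  increasing⇒inflationary : (f : Fin n → Fin n) → (∀ {i j} → i Fin.< j → f i Fin.< f j) → ∀ i → i Fin.≤ f i
  increasing⇒inflationary f mono i = go (toℕ i) i refl
    where
    go : ∀ k i → toℕ i ≡ k → k ℕ.≤ toℕ (f i)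
    go zero    i       _  = z≤n
    go (suc k) (suc i) eq = ℕ.≤-<-trans
      (go k (inject₁ i) (trans (Fin.toℕ-inject₁ i) (ℕ.suc-injective eq)))
      (mono (s≤s (ℕ.≤-reflexive (Fin.toℕ-inject₁ i))))

  order-agrees : {u v : Permutation′ n} → u ≼ v → v ≼ u → ∀ {i j} → u ⟨$⟩ʳ i Fin.< u ⟨$⟩ʳ j → v ⟨$⟩ʳ i Fin.< v ⟨$⟩ʳ j
  order-agrees {u = u} {v} u≼v v≼u {i} {j} lt with Fin.<-cmp i j
  ... | tri≈ _ refl _ = contradiction lt (ℕ.<-irrefl refl)
  ... | tri> _ _ j<i = proj₂ (u≼v (j<i , lt))
  ... | tri< i<j i≢j _ with Fin.<-cmp (v ⟨$⟩ʳ i) (v ⟨$⟩ʳ j)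
  ...   | tri< r _ _ = r
  ...   | tri≈ _ e _ = contradiction (⟨$⟩ʳ-injective v e) i≢j
  ...   | tri> _ _ r = contradiction (proj₂ (v≼u (i<j , r))) (ℕ.<-asym lt)

  ≼-antisym-≤ : {u v : Permutation′ n} → u ≼ v → v ≼ u → ∀ i → u ⟨$⟩ʳ i Fin.≤ v ⟨$⟩ʳ i
  ≼-antisym-≤ {u = u} {v} u≼v v≼u i =
    subst (λ k → u ⟨$⟩ʳ i Fin.≤ v ⟨$⟩ʳ k) (inverseˡ u)
      (increasing⇒inflationary (λ k → v ⟨$⟩ʳ (u ⟨$⟩ˡ k))
        (λ {i} {j} i<j → order-agrees {u = u} {v} u≼v v≼u
          (ℕ.<-≤-trans (ℕ.≤-<-trans (ℕ.≤-reflexive (cong toℕ (inverseʳ u))) i<j)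
             (ℕ.≤-reflexive (cong toℕ (sym (inverseʳ u))))))
        (u ⟨$⟩ʳ i))

≼-antisym : {u v : Permutation′ n} → u ≼ v → v ≼ u → u Perm.≈ v
≼-antisym {u = u} {v} u≼v v≼u i = Fin.≤-antisym (≼-antisym-≤ {u = u} {v} u≼v v≼u i) (≼-antisym-≤ {u = v} {u} v≼u u≼v i)

private
  module _ {A : Set} {P Q : A → Set} (P? : U.Decidable P) (Q? : U.Decidable Q) (P⊆Q : P U.⊆ Q) where

    filter-mono : ∀ xs → length (filter P? xs) ℕ.≤ length (filter Q? xs)
    filter-mono [] = z≤n
    filter-mono (x ∷ xs) with P? x | Q? x
    ... | yes p | yes q = s≤s (filter-mono xs)
    ... | yes p | no ¬q = contradiction (P⊆Q p) ¬q
    ... | no ¬p | yes q = ℕ.m≤n⇒m≤1+n (filter-mono xs)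
    ... | no ¬p | no ¬q = filter-mono xs

    filter-full : ∀ xs → length (filter Q? xs) ℕ.≤ length (filter P? xs) → ∀ {x} → x ∈ xs → Q x → P x
    filter-full (x ∷ xs) le x∈ qx with P? x | Q? x
    filter-full (x ∷ xs) le       (here refl) qx | yes p | _     = p
    filter-full (x ∷ xs) (s≤s le) (there x∈)  qx | yes p | yes q = filter-full xs le x∈ qx
    filter-full (x ∷ xs) le       (there x∈)  qx | yes p | no ¬q = contradiction (P⊆Q p) ¬q
    filter-full (x ∷ xs) le       x∈          qx | no ¬p | yes q = contradiction le (ℕ.<⇒≱ (s≤s (filter-mono xs)))
    filter-full (x ∷ xs) le       (here refl) qx | no ¬p | no ¬q = contradiction qx ¬q
    filter-full (x ∷ xs) le       (there x∈)  qx | no ¬p | no ¬q = filter-full xs le x∈ qx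

  pairs : ∀ n → List (Fin n × Fin n)
  pairs n = cartesianProduct (allFin n) (allFin n)

  #inv : Permutation′ n → ℕ
  #inv {n} u = length (filter (Inv? u) (pairs n))

  ≺⇒#inv< : {u v : Permutation′ n} → u ≺ v → #inv u ℕ.< #inv v
  ≺⇒#inv< {n} {u} {v} (u≼v , u≉v) = ℕ.≰⇒> λ le → u≉v (≼-antisym {u = u} {v} u≼v
    (λ {(i , j)} → filter-full (Inv? u) (Inv? v) u≼v (pairs n) le
      (∈.∈-cartesianProduct⁺ (∈.∈-allFin i) (∈.∈-allFin j))))

≺-wellFounded : WellFounded (_≺_ {n})
≺-wellFounded = Subrelation.wellFounded (λ {u} {v} → ≺⇒#inv< {u = u} {v}) (On.wellFounded #inv <-wellFounded)

sumℤ : List ℤ → ℤ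
sumℤ = foldr ℤ._+_ 0ℤ

-- μ(u,u) = 1, μ(u,v) = - Σ_{u ≤ w < v} μ(u,w) for u < v, and μ(u,v) = 0
-- otherwise; these equations, free of the accessibility argument, are
-- μ-refl, μ-≺ and μ-⋠ below.
private
  guarded : {P : Set} → Dec P → (P → ℤ) → ℤ
  guarded (yes p) f = f p
  guarded (no _)  f = 0ℤ

  guarded-cong : {P : Set} (P? : Dec P) {f g : P → ℤ} → (∀ p → f p ≡ g p) → guarded P? f ≡ guarded P? g
  guarded-cong (yes p) eq = eq p
  guarded-cong (no _)  eq = refl

  guarded-sum : {A : Set} {P : A → Set} (P? : U.Decidable P) (f : A → ℤ) (xs : List A) →
                sumℤ (map (λ x → guarded (P? x) (λ _ → f x)) xs) ≡ sumℤ (map f (filter P? xs))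
  guarded-sum P? f []       = refl
  guarded-sum P? f (x ∷ xs) with P? x
  ... | yes _ = cong (ℤ._+_ (f x)) (guarded-sum P? f xs)
  ... | no  _ = trans (ℤ.+-identityˡ _) (guarded-sum P? f xs)

  mutual
    μ′ : (u v : Permutation′ n) → Acc _≺_ v → ℤ
    μ′ {n} u v rs with u ≈? v | u ≼? v
    ... | yes _ | _     = 1ℤ
    ... | no  _ | yes _ = ℤ.- sumℤ (map (μ-term u v rs) (perms n))
    ... | no  _ | no  _ = 0ℤ

    μ-term : (u v : Permutation′ n) → Acc _≺_ v → Permutation′ n → ℤ
    μ-term u v (acc rs) w = guarded ((u ≼? w) ×-dec (w ≺? v)) λ (_ , w≺v) → μ′ u w (rs w≺v)

μ : Permutation′ n → Permutation′ n → ℤ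
μ u v = μ′ u v (≺-wellFounded v)

private
  mutual
    μ′-irr : (u v : Permutation′ n) (a b : Acc _≺_ v) → μ′ u v a ≡ μ′ u v b
    μ′-irr {n} u v a b with u ≈? v | u ≼? v
    ... | yes _ | _     = refl
    ... | no  _ | yes _ = cong (ℤ.-_ ∘ sumℤ) (List.map-cong (μ-term-irr u v a b) (perms n))
    ... | no  _ | no  _ = refl

    μ-term-irr : (u v : Permutation′ n) (a b : Acc _≺_ v) → ∀ w → μ-term u v a w ≡ μ-term u v b w
    μ-term-irr u v (acc rs) (acc rs′) w =
      guarded-cong ((u ≼? w) ×-dec (w ≺? v)) λ (_ , w≺v) → μ′-irr u w (rs w≺v) (rs′ w≺v)

  μ-terms : (u v : Permutation′ n) (a : Acc _≺_ v) (ws : List (Permutation′ n)) →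
            sumℤ (map (μ-term u v a) ws) ≡ sumℤ (map (μ u) (filter (λ w → (u ≼? w) ×-dec (w ≺? v)) ws))
  μ-terms u v (acc rs) ws = trans
    (cong sumℤ (List.map-cong (λ w → guarded-cong ((u ≼? w) ×-dec (w ≺? v))
      (λ (_ , w≺v) → μ′-irr u w (rs w≺v) (≺-wellFounded w))) ws))
    (guarded-sum (λ w → (u ≼? w) ×-dec (w ≺? v)) (μ u) ws)

μ-refl : {u v : Permutation′ n} → u Perm.≈ v → μ u v ≡ 1ℤ
μ-refl {u = u} {v} u≈v with u ≈? v | u ≼? v
... | yes _  | _ = refl
... | no u≉v | _ = contradiction u≈v u≉v

μ-≺ : {u v : Permutation′ n} → u ≺ v →
      μ u v ≡ ℤ.- sumℤ (map (μ u) (filter (λ w → (u ≼? w) ×-dec (w ≺? v)) (perms n)))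
μ-≺ {n} {u} {v} (u≼v , u≉v) with u ≈? v | u ≼? v
... | yes u≈v | _       = contradiction u≈v u≉v
... | no _    | no u⋠v  = contradiction (λ {x} → u≼v {x}) u⋠v
... | no _    | yes _   = cong ℤ.-_ (μ-terms u v (≺-wellFounded v) (perms n))

μ-⋠ : {u v : Permutation′ n} → ¬ u ≼ v → μ u v ≡ 0ℤ
μ-⋠ {u = u} {v} u⋠v with u ≈? v | u ≼? v
... | _ | yes u≼v = contradiction (λ {x} → u≼v {x}) u⋠v
... | no _ | no _ = refl
... | yes u≈v | no _ = contradiction
  (λ {(i , j)} (i<j , d) → i<j , subst (Fin._< (v ⟨$⟩ʳ i)) (u≈v j) (subst ((u ⟨$⟩ʳ j) Fin.<_) (u≈v i) d)) u⋠v

-- 𝔖Sym: the ℚ-vector space with basis 𝓕_u, u ∈ S_n, n ≥ 0, presented as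
-- formal linear combinations compared by their coefficients.

Basis : Set
Basis = Σ ℕ Permutation′

word : Basis → List ℕ
word (_ , u) = oneLine u

_≟ʷ_ : (b c : Basis) → Dec (word b ≡ word c)
b ≟ʷ c = List.≡-dec ℕ._≟_ (word b) (word c)

𝔖Sym : Set
𝔖Sym = List (ℚ × Basis)

coefficient : 𝔖Sym → Basis → ℚ
coefficient []            b = 0ℚ
coefficient ((q , c) ∷ x) b = (if does (c ≟ʷ b) then q else 0ℚ) ℚ.+ coefficient x b

infix  4 _≈ˢ_
infixl 6 _+ˢ_
infixl 7 _·ˢ_

_≈ˢ_ : 𝔖Sym → 𝔖Sym → Set
x ≈ˢ y = ∀ b → coefficient x b ≡ coefficient y b

_+ˢ_ : 𝔖Sym → 𝔖Sym → 𝔖Sym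
_+ˢ_ = _++_

_·ˢ_ : ℚ → 𝔖Sym → 𝔖Sym
q ·ˢ x = map (λ (r , b) → q ℚ.* r , b) x

𝓕 : Permutation′ n → 𝔖Sym
𝓕 {n} u = (1ℚ , n , u) ∷ []

sumˢ : List 𝔖Sym → 𝔖Sym
sumˢ = foldr _+ˢ_ []

ℳ : Permutation′ n → 𝔖Sym
ℳ {n} u = sumˢ (map (λ v → (μ u v ℚ./ 1) ·ˢ 𝓕 v) (filter (u ≼?_) (perms n)))

-- x_{i₁}^{a₁} ⋯ x_{iₖ}^{aₖ} with i₁ < ⋯ < iₖ and all aⱼ > 0, given by the
-- list of the pairs (iⱼ , aⱼ).  The variables are indexed from 0.
record Monomial : Set where
  field
    factors    : List (ℕ × ℕ)
    increasing : Linked (ℕ._<_ on proj₁) factors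
    positive   : All (λ (_ , a) → 0 ℕ.< a) factors

  exponents : List ℕ
  exponents = map proj₂ factors

open Monomial public using (exponents)

-- Formal power series of bounded degree in which x_{i₁}^{a₁} ⋯ x_{iₖ}^{aₖ}
-- and x_{j₁}^{a₁} ⋯ x_{jₖ}^{aₖ} (i₁ < ⋯ < iₖ, j₁ < ⋯ < jₖ) have the same
-- coefficient.
record QSym : Set where
  field
    coeff          : Monomial → ℚ
    quasisymmetric : ∀ s t → exponents s ≡ exponents t → coeff s ≡ coeff t
    bounded        : ∃ λ d → ∀ s → d ℕ.< sum (exponents s) → coeff s ≡ 0ℚ

open QSym public

infix  4 _≈_
infixl 6 _+_
infixl 7 _·_

_≈_ : QSym → QSym → Set
f ≈ g = ∀ s → coeff f s ≡ coeff g s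

𝟘 : QSym
𝟘 .coeff _              = 0ℚ
𝟘 .quasisymmetric _ _ _ = refl
𝟘 .bounded              = 0 , λ _ _ → refl

_+_ : QSym → QSym → QSym
(f + g) .coeff s              = coeff f s ℚ.+ coeff g s
(f + g) .quasisymmetric s t e = cong₂ ℚ._+_ (quasisymmetric f s t e) (quasisymmetric g s t e)
(f + g) .bounded with d , p ← bounded f | e , q ← bounded g =
  d ℕ.+ e , λ s lt → cong₂ ℚ._+_ (p s (ℕ.≤-<-trans (ℕ.m≤m+n d e) lt)) (q s (ℕ.≤-<-trans (ℕ.m≤n+m e d) lt))

_·_ : ℚ → QSym → QSym
(q · f) .coeff s              = q ℚ.* coeff f s
(q · f) .quasisymmetric s t e = cong (q ℚ.*_) (quasisymmetric f s t e)
(q · f) .bounded with d , p ← bounded f =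
  d , λ s lt → trans (cong (q ℚ.*_) (p s lt)) (ℚ.*-zeroʳ q)

sumQ : List QSym → QSym
sumQ = foldr _+_ 𝟘

differences : ℕ → ℕ → List ℕ → List ℕ
differences n i []       = (n ∸ i) ∷ []
differences n i (j ∷ js) = (j ∸ i) ∷ differences n j js

composition : ∀ n → Subset (pred n) → List ℕ
composition zero      J = []
composition n@(suc _) J = differences n 0 (elements J)

-- Σ_{i₁<⋯<iₖ} x_{i₁}^{α₁} ⋯ x_{iₖ}^{αₖ}: the summands are distinct, and they
-- are the monomials whose list of exponents is α.
monomialQSym : List ℕ → QSym
monomialQSym α .coeff s = if does (List.≡-dec ℕ._≟_ (exponents s) α) then 1ℚ else 0ℚ
monomialQSym α .quasisymmetric s t e = cong (λ β → if does (List.≡-dec ℕ._≟_ β α) then 1ℚ else 0ℚ) e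
monomialQSym α .bounded = sum α , λ s lt →
  cong (if_then 1ℚ else 0ℚ)
    (dec-false (List.≡-dec ℕ._≟_ (exponents s) α) λ e → ℕ.<-irrefl (cong sum (sym e)) lt)

M : ∀ n → Subset (pred n) → QSym
M n J = monomialQSym (composition n J)

subsets : ∀ n → List (Subset n)
subsets zero    = [] ∷ []
subsets (suc n) = map (outside ∷_) (subsets n) ++ map (inside ∷_) (subsets n)

F : ∀ n → Subset (pred n) → QSym
F n J = sumQ (map (M n) (filter (J ⊆?_) (subsets (pred n))))

-- The linear extension of 𝓕_u ↦ F_{Des(u)}; 𝒟-cong shows that it is well
-- defined on formal linear combinations.

𝒟 : 𝔖Sym → QSym
𝒟 x = sumQ (map (λ (q , n , u) → q · F n (Des u)) x)

𝒟-𝓕 : (u : Permutation′ n) → 𝒟 (𝓕 u) ≈ F n (Des u)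
𝒟-𝓕 u s = trans (ℚ.+-identityʳ _) (ℚ.*-identityˡ _)

𝒟-+ : ∀ x y → 𝒟 (x +ˢ y) ≈ 𝒟 x + 𝒟 y
𝒟-+ []      y s = sym (ℚ.+-identityˡ _)
𝒟-+ ((q , n , u) ∷ x) y s = trans (cong (ℚ._+_ t) (𝒟-+ x y s)) (sym (ℚ.+-assoc t (coeff (𝒟 x) s) (coeff (𝒟 y) s)))
  where t = q ℚ.* coeff (F n (Des u)) s

𝒟-· : ∀ q x → 𝒟 (q ·ˢ x) ≈ q · 𝒟 x
𝒟-· q []            s = sym (ℚ.*-zeroʳ q)
𝒟-· q ((r , n , u) ∷ x) s =
  trans (cong₂ ℚ._+_ (ℚ.*-assoc q r f) (𝒟-· q x s)) (sym (ℚ.*-distribˡ-+ q (r ℚ.* f) (coeff (𝒟 x) s)))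
  where f = coeff (F n (Des u)) s

private
  tabulate-injective : {f g : Fin n → ℕ} → List.tabulate f ≡ List.tabulate g → ∀ i → f i ≡ g i
  tabulate-injective eq zero    = List.∷-injectiveˡ eq
  tabulate-injective eq (suc i) = tabulate-injective (List.∷-injectiveʳ eq) i

  Des-cong : {u v : Permutation′ n} → u Perm.≈ v → Des u ≡ Des v
  Des-cong {zero}  u≈v = refl
  Des-cong {suc n} u≈v = Vec.tabulate-cong λ k →
    cong₂ (λ a b → does (a Fin.<? b)) (u≈v (suc k)) (u≈v (inject₁ k))

  F-Des-cong : ∀ b c → word b ≡ word c → F (proj₁ b) (Des (proj₂ b)) ≡ F (proj₁ c) (Des (proj₂ c))
  F-Des-cong (m , u) (n , v) eq = go (trans (sym (List.length-tabulate _)) (trans (cong length eq) (List.length-tabulate _))) v eq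
    where
    go : ∀ {n} → m ≡ n → (v : Permutation′ n) → oneLine u ≡ oneLine v → F m (Des u) ≡ F n (Des v)
    go refl v eq = cong (F m) (Des-cong {u = u} {v} λ i → Fin.toℕ-injective (ℕ.suc-injective (tabulate-injective eq i)))

  without : Basis → 𝔖Sym → 𝔖Sym
  without b = filter (λ (_ , c) → ¬? (c ≟ʷ b))

  coefficient-without-same : ∀ b x c → word b ≡ word c → coefficient (without b x) c ≡ 0ℚ
  coefficient-without-same b []            c eq = refl
  coefficient-without-same b ((q , d) ∷ x) c eq with d ≟ʷ b
  ... | yes _ = coefficient-without-same b x c eq
  ... | no d≢b rewrite dec-false (d ≟ʷ c) (λ d≡c → d≢b (trans d≡c (sym eq))) =
    trans (ℚ.+-identityˡ _) (coefficient-without-same b x c eq)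

  coefficient-without-other : ∀ b x c → word b ≢ word c → coefficient (without b x) c ≡ coefficient x c
  coefficient-without-other b []            c neq = refl
  coefficient-without-other b ((q , d) ∷ x) c neq with d ≟ʷ b
  ... | no _    = cong (ℚ._+_ (if does (d ≟ʷ c) then q else 0ℚ)) (coefficient-without-other b x c neq)
  ... | yes d≡b rewrite dec-false (d ≟ʷ c) (λ d≡c → neq (trans (sym d≡b) d≡c)) =
    trans (coefficient-without-other b x c neq) (sym (ℚ.+-identityˡ _))

  𝒟-split : ∀ b x s → coeff (𝒟 x) s ≡
            coefficient x b ℚ.* coeff (F (proj₁ b) (Des (proj₂ b))) s ℚ.+ coeff (𝒟 (without b x)) s
  𝒟-split b []            s = sym (trans (ℚ.+-identityʳ _) (ℚ.*-zeroˡ (coeff (F (proj₁ b) (Des (proj₂ b))) s)))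
  𝒟-split b ((q , c) ∷ x) s with c ≟ʷ b
  ... | yes c≡b = begin
    q ℚ.* Fc ℚ.+ coeff (𝒟 x) s                        ≡⟨ cong₂ (λ h r → q ℚ.* coeff h s ℚ.+ r) (F-Des-cong c b c≡b) (𝒟-split b x s) ⟩
    q ℚ.* Fb ℚ.+ (coefficient x b ℚ.* Fb ℚ.+ rest)    ≡⟨ ℚ.+-assoc (q ℚ.* Fb) _ rest ⟨
    (q ℚ.* Fb ℚ.+ coefficient x b ℚ.* Fb) ℚ.+ rest    ≡⟨ cong (ℚ._+ rest) (ℚ.*-distribʳ-+ Fb q (coefficient x b)) ⟨
    (q ℚ.+ coefficient x b) ℚ.* Fb ℚ.+ rest           ∎
    where
    open ≡-Reasoning
    Fb = coeff (F (proj₁ b) (Des (proj₂ b))) s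
    Fc = coeff (F (proj₁ c) (Des (proj₂ c))) s
    rest = coeff (𝒟 (without b x)) s
  ... | no c≢b = begin
    t ℚ.+ coeff (𝒟 x) s         ≡⟨ cong (t ℚ.+_) (𝒟-split b x s) ⟩
    t ℚ.+ (k ℚ.* Fb ℚ.+ rest)   ≡⟨ ℚ.+-assoc t (k ℚ.* Fb) rest ⟨
    (t ℚ.+ k ℚ.* Fb) ℚ.+ rest   ≡⟨ cong (ℚ._+ rest) (ℚ.+-comm t (k ℚ.* Fb)) ⟩
    (k ℚ.* Fb ℚ.+ t) ℚ.+ rest   ≡⟨ ℚ.+-assoc (k ℚ.* Fb) t rest ⟩
    k ℚ.* Fb ℚ.+ (t ℚ.+ rest)   ≡⟨ cong (λ z → z ℚ.* Fb ℚ.+ (t ℚ.+ rest)) (ℚ.+-identityˡ k) ⟨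
    (0ℚ ℚ.+ k) ℚ.* Fb ℚ.+ (t ℚ.+ rest) ∎
    where
    open ≡-Reasoning
    Fb = coeff (F (proj₁ b) (Des (proj₂ b))) s
    t = q ℚ.* coeff (F (proj₁ c) (Des (proj₂ c))) s
    k = coefficient x b
    rest = coeff (𝒟 (without b x)) s

  𝒟-zero : ∀ k x → length x ℕ.≤ k → x ≈ˢ [] → 𝒟 x ≈ 𝟘
  𝒟-zero k       []            le       x≈0 s = refl
  𝒟-zero (suc k) x@((q , b) ∷ x′) (s≤s le) x≈0 s = begin
    coeff (𝒟 x) s                             ≡⟨ 𝒟-split b x s ⟩
    coefficient x b ℚ.* Fb ℚ.+ coeff (𝒟 (without b x)) s ≡⟨ cong₂ (λ c r → c ℚ.* Fb ℚ.+ r) (x≈0 b) (𝒟-zero k (without b x) shorter vanish s) ⟩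
    0ℚ ℚ.* Fb ℚ.+ 0ℚ                         ≡⟨ trans (ℚ.+-identityʳ _) (ℚ.*-zeroˡ Fb) ⟩
    0ℚ                                       ∎
    where
    open ≡-Reasoning
    Fb = coeff (F (proj₁ b) (Des (proj₂ b))) s
    shorter : length (without b x) ℕ.≤ k
    shorter rewrite dec-true (b ≟ʷ b) refl = ℕ.≤-trans (List.length-filter (λ (_ , c) → ¬? (c ≟ʷ b)) x′) le
    vanish : without b x ≈ˢ []
    vanish c with b ≟ʷ c
    ... | yes eq = coefficient-without-same b x c eq
    ... | no neq = trans (coefficient-without-other b x c neq) (x≈0 c)

  coefficient-++ : ∀ x y b → coefficient (x +ˢ y) b ≡ coefficient x b ℚ.+ coefficient y b
  coefficient-++ []            y b = sym (ℚ.+-identityˡ _)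
  coefficient-++ ((q , c) ∷ x) y b =
    trans (cong (ℚ._+_ (if does (c ≟ʷ b) then q else 0ℚ)) (coefficient-++ x y b))
      (sym (ℚ.+-assoc (if does (c ≟ʷ b) then q else 0ℚ) (coefficient x b) (coefficient y b)))

  coefficient-neg : ∀ x b → coefficient ((- 1ℚ) ·ˢ x) b ≡ - coefficient x b
  coefficient-neg []            b = refl
  coefficient-neg ((q , c) ∷ x) b with does (c ≟ʷ b)
  ... | true  = trans (cong₂ ℚ._+_ (trans (sym (ℚ.neg-distribˡ-* 1ℚ q)) (cong -_ (ℚ.*-identityˡ q))) (coefficient-neg x b)) (sym (ℚ.neg-distrib-+ q (coefficient x b)))
  ... | false = trans (ℚ.+-identityˡ _) (trans (coefficient-neg x b) (cong -_ (sym (ℚ.+-identityˡ _))))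

𝒟-cong : ∀ x y → x ≈ˢ y → 𝒟 x ≈ 𝒟 y
𝒟-cong x y x≈y s = begin
  dx                     ≡⟨ ℚ.+-identityʳ dx ⟨
  dx ℚ.+ 0ℚ              ≡⟨ cong (dx ℚ.+_) (ℚ.+-inverseˡ dy) ⟨
  dx ℚ.+ (- dy ℚ.+ dy)   ≡⟨ ℚ.+-assoc dx (- dy) dy ⟨
  (dx ℚ.+ - dy) ℚ.+ dy   ≡⟨ cong (ℚ._+ dy) difference ⟩
  0ℚ ℚ.+ dy              ≡⟨ ℚ.+-identityˡ dy ⟩
  dy                     ∎
  where
  open ≡-Reasoning
  dx = coeff (𝒟 x) s
  dy = coeff (𝒟 y) s
  z = x +ˢ (- 1ℚ) ·ˢ y
  z≈0 : z ≈ˢ []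
  z≈0 b = trans (coefficient-++ x _ b) (trans (cong₂ ℚ._+_ (x≈y b) (coefficient-neg y b)) (ℚ.+-inverseʳ (coefficient y b)))
  difference : dx ℚ.+ - dy ≡ 0ℚ
  difference = begin
    dx ℚ.+ - dy            ≡⟨ cong (λ r → dx ℚ.+ - r) (ℚ.*-identityˡ dy) ⟨
    dx ℚ.+ - (1ℚ ℚ.* dy)   ≡⟨ cong (dx ℚ.+_) (ℚ.neg-distribˡ-* 1ℚ dy) ⟩
    dx ℚ.+ (- 1ℚ) ℚ.* dy   ≡⟨ cong (dx ℚ.+_) (𝒟-· (- 1ℚ) y s) ⟨
    dx ℚ.+ coeff (𝒟 ((- 1ℚ) ·ˢ y)) s ≡⟨ 𝒟-+ x ((- 1ℚ) ·ˢ y) s ⟨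
    coeff (𝒟 z) s          ≡⟨ 𝒟-zero (length z) z ℕ.≤-refl z≈0 s ⟩
    0ℚ                     ∎

{-# OPTIONS --safe #-}

-- The inversions of ζ_K are the pairs i < j separated by some p ∈ K (i ≤ p < j),
-- so Des(v) ⊆ K if and only if v ≤ ζ_K in the weak order.  Hence the coefficient
-- of M_K in 𝒟(ℳ_u) is the sum of μ(u,v) over u ≤ v ≤ ζ_K, which is 1 if u = ζ_K
-- and 0 otherwise; moreover GDes(ζ_K) = K.

module Submission where

open import Defs
open import Data.Bool.Base using (if_then_else_)
open import Data.Fin.Base as Fin using (Fin; zero; suc; toℕ; fromℕ; inject₁; punchIn)
import Data.Fin.Properties as Fin
open import Data.Fin.Induction using (<-weakInduction)
open import Data.Fin.Permutation as Perm using (Permutation′; _⟨$⟩ʳ_; insert)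
open import Data.Fin.Subset using (Subset; _∈_; _⊆_; inside; outside)
open import Data.Fin.Subset.Properties using (_∈?_; _⊆?_; ⊆-antisym)
open import Data.Integer.Base as ℤ using (ℤ)
import Data.Integer.Properties as ℤ
open import Data.List.Base as List using (List; []; _∷_; _++_; map; filter; tabulate; upTo)
import Data.List.Properties as List
open import Data.List.Membership.Propositional using () renaming (_∈_ to _∈ₗ_)
import Data.List.Membership.Propositional.Properties as ∈ₗ
open import Data.List.Relation.Unary.All as All using (All; []; _∷_)
import Data.List.Relation.Unary.All.Properties as All
open import Data.List.Relation.Unary.AllPairs as AllPairs using (AllPairs; []; _∷_)
import Data.List.Relation.Unary.AllPairs.Properties as AllPairs
open import Data.List.Relation.Unary.Any as Any using (Any; here; there)
open import Data.List.Relation.Unary.Unique.Propositional using (Unique)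
import Data.List.Relation.Unary.Unique.Propositional.Properties as Unique
open import Data.Nat.Base as ℕ using (ℕ; zero; suc; _≤_; _<_; _∸_; z≤n; s≤s)
import Data.Nat.Properties as ℕ
open import Data.Product.Base using (∃; _×_; _,_; proj₂)
open import Data.Rational.Base as ℚ using (ℚ; 0ℚ; 1ℚ)
import Data.Rational.Properties as ℚ
import Data.Rational.Unnormalised.Base as ℚᵘ
import Data.Rational.Unnormalised.Properties as ℚᵘ
open import Data.Vec.Base as Vec using ([]; _∷_; here; there)
import Data.Vec.Properties as Vec
open import Function.Base using (_∘_)
open import Relation.Binary.PropositionalEquality using (_≡_; refl; sym; trans; cong; cong₂; subst; subst₂; module ≡-Reasoning)
open import Relation.Nullary using (¬_; Dec; yes; no; does; contradiction)
open import Relation.Nullary.Decidable using (_×-dec_; ¬?; dec-true; dec-false)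
import Relation.Unary as U

private
  variable
    n : ℕ
    A B : Set
    P Q : Set

-- Finite sums and indicators

∑ : List A → (A → ℚ) → ℚ
∑ []       f = 0ℚ
∑ (x ∷ xs) f = f x ℚ.+ ∑ xs f

∑-cong : ∀ (xs : List A) {f g} → (∀ x → f x ≡ g x) → ∑ xs f ≡ ∑ xs g
∑-cong []       eq = refl
∑-cong (x ∷ xs) eq = cong₂ ℚ._+_ (eq x) (∑-cong xs eq)

∑-zero : ∀ (xs : List A) {f} → (∀ x → f x ≡ 0ℚ) → ∑ xs f ≡ 0ℚ
∑-zero []       eq = refl
∑-zero (x ∷ xs) eq = cong₂ ℚ._+_ (eq x) (∑-zero xs eq)

+-interchange : ∀ a b c d → (a ℚ.+ b) ℚ.+ (c ℚ.+ d) ≡ (a ℚ.+ c) ℚ.+ (b ℚ.+ d)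
+-interchange a b c d = begin
  (a ℚ.+ b) ℚ.+ (c ℚ.+ d)  ≡⟨ ℚ.+-assoc a b (c ℚ.+ d) ⟩
  a ℚ.+ (b ℚ.+ (c ℚ.+ d))  ≡⟨ cong (a ℚ.+_) (ℚ.+-assoc b c d) ⟨
  a ℚ.+ ((b ℚ.+ c) ℚ.+ d)  ≡⟨ cong (λ x → a ℚ.+ (x ℚ.+ d)) (ℚ.+-comm b c) ⟩
  a ℚ.+ ((c ℚ.+ b) ℚ.+ d)  ≡⟨ cong (a ℚ.+_) (ℚ.+-assoc c b d) ⟩
  a ℚ.+ (c ℚ.+ (b ℚ.+ d))  ≡⟨ ℚ.+-assoc a c (b ℚ.+ d) ⟨
  (a ℚ.+ c) ℚ.+ (b ℚ.+ d)  ∎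
  where open ≡-Reasoning

∑-+ : ∀ (xs : List A) f g → ∑ xs (λ x → f x ℚ.+ g x) ≡ ∑ xs f ℚ.+ ∑ xs g
∑-+ []       f g = refl
∑-+ (x ∷ xs) f g = trans (cong ((f x ℚ.+ g x) ℚ.+_) (∑-+ xs f g))
  (+-interchange (f x) (g x) (∑ xs f) (∑ xs g))

∑-*ˡ : ∀ (xs : List A) c f → ∑ xs (λ x → c ℚ.* f x) ≡ c ℚ.* ∑ xs f
∑-*ˡ []       c f = sym (ℚ.*-zeroʳ c)
∑-*ˡ (x ∷ xs) c f = trans (cong (c ℚ.* f x ℚ.+_) (∑-*ˡ xs c f)) (sym (ℚ.*-distribˡ-+ c (f x) (∑ xs f)))

∑-swap : ∀ (xs : List A) (ys : List B) (f : A → B → ℚ) →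
         ∑ xs (λ x → ∑ ys (f x)) ≡ ∑ ys (λ y → ∑ xs (λ x → f x y))
∑-swap []       ys f = sym (∑-zero ys λ _ → refl)
∑-swap (x ∷ xs) ys f = trans (cong (∑ ys (f x) ℚ.+_) (∑-swap xs ys f))
  (sym (∑-+ ys (f x) (λ y → ∑ xs (λ x → f x y))))

-- Iverson bracket. It turns a sum over a filtered list into a weighted sum over a fixed list, so
-- that sums can be exchanged and conditions replaced by equivalent ones.
⟦_⟧ : Dec P → ℚ
⟦ d ⟧ = if does d then 1ℚ else 0ℚ

⟦⟧-cong : (P? : Dec P) (Q? : Dec Q) → (P → Q) → (Q → P) → ⟦ P? ⟧ ≡ ⟦ Q? ⟧
⟦⟧-cong (yes p) (yes q) f g = refl
⟦⟧-cong (yes p) (no ¬q) f g = contradiction (f p) ¬q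
⟦⟧-cong (no ¬p) (yes q) f g = contradiction (g q) ¬p
⟦⟧-cong (no ¬p) (no ¬q) f g = refl

⟦⟧-yes : (P? : Dec P) → P → ⟦ P? ⟧ ≡ 1ℚ
⟦⟧-yes (yes _) p = refl
⟦⟧-yes (no ¬p) p = contradiction p ¬p

⟦⟧-no : (P? : Dec P) → ¬ P → ⟦ P? ⟧ ≡ 0ℚ
⟦⟧-no (yes p) ¬p = contradiction p ¬p
⟦⟧-no (no _)  ¬p = refl

⟦⟧*-no : (P? : Dec P) → ¬ P → ∀ q → ⟦ P? ⟧ ℚ.* q ≡ 0ℚ
⟦⟧*-no P? ¬p q = trans (cong (ℚ._* q) (⟦⟧-no P? ¬p)) (ℚ.*-zeroˡ q)

⟦⟧*-yes : (P? : Dec P) → P → ∀ q → ⟦ P? ⟧ ℚ.* q ≡ q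
⟦⟧*-yes P? p q = trans (cong (ℚ._* q) (⟦⟧-yes P? p)) (ℚ.*-identityˡ q)

∑-filter : {P : A → Set} (P? : U.Decidable P) (xs : List A) (f : A → ℚ) →
           ∑ (filter P? xs) f ≡ ∑ xs (λ x → ⟦ P? x ⟧ ℚ.* f x)
∑-filter P? []       f = refl
∑-filter P? (x ∷ xs) f with P? x
... | yes _ = cong₂ ℚ._+_ (sym (ℚ.*-identityˡ (f x))) (∑-filter P? xs f)
... | no  _ = trans (∑-filter P? xs f)
  (trans (sym (ℚ.+-identityˡ _)) (cong (ℚ._+ _) (sym (ℚ.*-zeroˡ (f x)))))

∑-none : {P : A → Set} (P? : U.Decidable P) {xs : List A} (f : A → ℚ) →
         All (λ x → ¬ P x) xs → ∑ xs (λ x → ⟦ P? x ⟧ ℚ.* f x) ≡ 0ℚ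
∑-none P? f []         = refl
∑-none P? f (¬p ∷ ¬ps) = cong₂ ℚ._+_ (⟦⟧*-no (P? _) ¬p (f _)) (∑-none P? f ¬ps)

-- The two list hypotheses say that exactly one entry satisfies `P`. Neither mentions equality of
-- entries, so permutations, which are distinguished only up to `≈`, are covered.
∑-single : {P : A → Set} (P? : U.Decidable P) {xs : List A} (f : A → ℚ) {c : ℚ} →
           AllPairs (λ x y → P x → ¬ P y) xs → Any P xs → (∀ x → P x → f x ≡ c) →
           ∑ xs (λ x → ⟦ P? x ⟧ ℚ.* f x) ≡ c
∑-single P? f (¬ps ∷ _) (here px) eq = trans
  (cong₂ ℚ._+_ (trans (⟦⟧*-yes (P? _) px (f _)) (eq _ px)) (∑-none P? f (All.map (λ ¬p → ¬p px) ¬ps)))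
  (ℚ.+-identityʳ _)
∑-single {P = P} P? f (¬ps ∷ u) (there ps) eq = trans
  (cong₂ ℚ._+_ (⟦⟧*-no (P? _) (λ px → ¬head px) (f _)) (∑-single P? f u ps eq))
  (ℚ.+-identityˡ _)
  where
  ¬head : ¬ P _
  ¬head px = All.lookupWith (λ ¬p py → ¬p px py) ¬ps ps

-- Elements of ℚ are stored in lowest terms, so additivity does not hold by computation; the proof
-- passes to unnormalised fractions with denominator 1.
/1-+ : ∀ i j → (i ℤ.+ j) ℚ./ 1 ≡ i ℚ./ 1 ℚ.+ j ℚ./ 1
/1-+ i j = ℚ.toℚᵘ-injective (begin-equality
  ℚ.toℚᵘ ((i ℤ.+ j) ℚ./ 1)                    ≃⟨ ℚ.toℚᵘ-fromℚᵘ (ℚᵘ.mkℚᵘ (i ℤ.+ j) 0) ⟩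
  ℚᵘ.mkℚᵘ (i ℤ.+ j) 0                         ≡⟨ cong (λ k → ℚᵘ.mkℚᵘ k 0) (cong₂ ℤ._+_ (ℤ.*-identityʳ i) (ℤ.*-identityʳ j)) ⟨
  ℚᵘ.mkℚᵘ i 0 ℚᵘ.+ ℚᵘ.mkℚᵘ j 0                ≃⟨ ℚᵘ.+-cong (ℚ.toℚᵘ-fromℚᵘ (ℚᵘ.mkℚᵘ i 0)) (ℚ.toℚᵘ-fromℚᵘ (ℚᵘ.mkℚᵘ j 0)) ⟨
  ℚ.toℚᵘ (i ℚ./ 1) ℚᵘ.+ ℚ.toℚᵘ (j ℚ./ 1)      ≃⟨ ℚ.toℚᵘ-homo-+ (i ℚ./ 1) (j ℚ./ 1) ⟨
  ℚ.toℚᵘ (i ℚ./ 1 ℚ.+ j ℚ./ 1)                ∎)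
  where open ℚᵘ.≤-Reasoning

sumℤ-/1 : ∀ (xs : List A) f → sumℤ (map f xs) ℚ./ 1 ≡ ∑ xs (λ x → f x ℚ./ 1)
sumℤ-/1 []       f = refl
sumℤ-/1 (x ∷ xs) f = trans (/1-+ (f x) _) (cong (f x ℚ./ 1 ℚ.+_) (sumℤ-/1 xs f))

-- Möbius inversion in the weak order

≼-trans : {u v w : Permutation′ n} → u ≼ v → v ≼ w → u ≼ w
≼-trans u≼v v≼w {x} p = v≼w {x} (u≼v {x} p)

≈⇒≼ : {u v : Permutation′ n} → u Perm.≈ v → u ≼ v
≈⇒≼ u≈v {i , j} (i<j , d) = i<j , subst₂ Fin._<_ (u≈v j) (u≈v i) d

≈-sym : {u v : Permutation′ n} → u Perm.≈ v → v Perm.≈ u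
≈-sym u≈v i = sym (u≈v i)

≈-trans : {u v w : Permutation′ n} → u Perm.≈ v → v Perm.≈ w → u Perm.≈ w
≈-trans u≈v v≈w i = trans (u≈v i) (v≈w i)

≺-respʳ-≈ : {u v w : Permutation′ n} → v Perm.≈ w → u ≺ v → u ≺ w
≺-respʳ-≈ {u = u} {v} {w} v≈w (u≼v , u≉v) =
  ≼-trans {u = u} {v} {w} u≼v (≈⇒≼ {u = v} {w} v≈w) ,
  λ u≈w → u≉v (≈-trans {u = u} {w} {v} u≈w (≈-sym {u = v} {w} v≈w))

-- Pointwise equal permutations need not be propositionally equal, so invariance is read off from
-- the recursion for `μ`: the half-open intervals [u, v) and [u, w) select the same entries of
-- `perms n`.
μ-congʳ : {u v w : Permutation′ n} → u ≺ v → v Perm.≈ w → μ u v ≡ μ u w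
μ-congʳ {n} {u} {v} {w} u≺v v≈w = trans (μ-≺ {u = u} {v} u≺v) (trans
  (cong (ℤ.-_ ∘ sumℤ ∘ map (μ u)) (List.filter-≐ (λ x → (u ≼? x) ×-dec (x ≺? v)) (λ x → (u ≼? x) ×-dec (x ≺? w))
    ( (λ {x} (u≼x , x≺v) → u≼x , ≺-respʳ-≈ {u = x} {v} {w} v≈w x≺v)
    , (λ {x} (u≼x , x≺w) → u≼x , ≺-respʳ-≈ {u = x} {w} {v} (≈-sym {u = v} {w} v≈w) x≺w))
    (perms n)))
  (sym (μ-≺ {u = u} {w} (≺-respʳ-≈ {u = u} {v} {w} v≈w u≺v))))

-- `perms n` lists one representative of `w`, not necessarily `w` itself; hence the condition on `f`
-- concerns every permutation pointwise equal to `w`.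
∑-≈ : (w : Permutation′ n) (f : Permutation′ n → ℚ) {c : ℚ} → (∀ v → v Perm.≈ w → f v ≡ c) →
      ∑ (perms n) (λ v → ⟦ v ≈? w ⟧ ℚ.* f v) ≡ c
∑-≈ {n} w f = ∑-single (_≈? w) f
  (AllPairs.map (λ {u} {v} u≉v u≈w v≈w → u≉v (≈-trans {u = u} {w} {v} u≈w (≈-sym {u = v} {w} v≈w))) (perms-unique n))
  (Any.map (λ {v} w≈v → ≈-sym {u = w} {v} w≈v) (perms-complete w))

0*+ : ∀ q r → 0ℚ ℚ.* q ℚ.+ r ≡ r
0*+ q r = trans (cong (ℚ._+ r) (ℚ.*-zeroˡ q)) (ℚ.+-identityˡ r)

-- With `P`, `Q`, `C` being u ≤ v, v ≤ w, v ≈ w, this separates the top of an interval from the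
-- rest; the last indicator is then `(u ≼? v) ×-dec (v ≺? w)` with `≺?` unfolded.
split-top : {C : Set} (P? : Dec P) (Q? : Dec Q) (C? : Dec C) → (C → P) → (C → Q) → ∀ q →
            ⟦ P? ⟧ ℚ.* (⟦ Q? ⟧ ℚ.* q) ≡ ⟦ C? ⟧ ℚ.* q ℚ.+ ⟦ P? ×-dec (Q? ×-dec ¬? C?) ⟧ ℚ.* q
split-top P? Q? (yes c) f g q = trans
  (trans (⟦⟧*-yes P? (f c) _) (⟦⟧*-yes Q? (g c) q))
  (sym (trans (cong₂ ℚ._+_ (ℚ.*-identityˡ q) (⟦⟧*-no (P? ×-dec (Q? ×-dec ¬? (yes c))) (λ (_ , _ , ¬c) → ¬c c) q))
    (ℚ.+-identityʳ q)))
split-top (yes _) (yes _) (no _) f g q = trans (ℚ.*-identityˡ (1ℚ ℚ.* q)) (sym (0*+ q (1ℚ ℚ.* q)))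
split-top (yes _) (no _)  (no _) f g q = trans (ℚ.*-identityˡ (0ℚ ℚ.* q)) (sym (0*+ q (0ℚ ℚ.* q)))
split-top (no _)  Q?      (no _) f g q = trans (ℚ.*-zeroˡ (⟦ Q? ⟧ ℚ.* q))
  (sym (trans (0*+ q (0ℚ ℚ.* q)) (ℚ.*-zeroˡ q)))

-- By the recursion for μ(u,w), the term v = w cancels the terms v < w. When u = w only the top term
-- 1 survives, and when u ≰ w the interval is empty.
∑-μ-interval : (u w : Permutation′ n) →
               ∑ (perms n) (λ v → ⟦ u ≼? v ⟧ ℚ.* (⟦ v ≼? w ⟧ ℚ.* (μ u v ℚ./ 1))) ≡ ⟦ u ≈? w ⟧
∑-μ-interval {n} u w = go (u ≼? w) (u ≈? w)
  where
  open ≡-Reasoning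

  m : Permutation′ n → ℚ
  m v = μ u v ℚ./ 1

  below : ℚ
  below = ∑ (perms n) (λ v → ⟦ (u ≼? v) ×-dec (v ≺? w) ⟧ ℚ.* m v)

  decompose : u ≼ w → ∑ (perms n) (λ v → ⟦ u ≼? v ⟧ ℚ.* (⟦ v ≼? w ⟧ ℚ.* m v)) ≡
              ∑ (perms n) (λ v → ⟦ v ≈? w ⟧ ℚ.* m v) ℚ.+ below
  decompose u≼w = trans
    (∑-cong (perms n) λ v → split-top (u ≼? v) (v ≼? w) (v ≈? w)
      (λ v≈w {x} p → ≈⇒≼ {u = w} {v} (≈-sym {u = v} {w} v≈w) {x} (u≼w {x} p))
      (λ v≈w {x} → ≈⇒≼ {u = v} {w} v≈w {x}) (m v))
    (∑-+ (perms n) (λ v → ⟦ v ≈? w ⟧ ℚ.* m v) _)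

  go : (d : Dec (u ≼ w)) (e : Dec (u Perm.≈ w)) →
       ∑ (perms n) (λ v → ⟦ u ≼? v ⟧ ℚ.* (⟦ v ≼? w ⟧ ℚ.* m v)) ≡ ⟦ e ⟧
  go (no u⋠w) (yes u≈w) = contradiction (λ {x} → ≈⇒≼ {u = u} {w} u≈w {x}) u⋠w
  go (no u⋠w) (no _) = ∑-zero (perms n) λ v → vanish v (u ≼? v) (v ≼? w)
    where
    vanish : ∀ v (p : Dec (u ≼ v)) (q : Dec (v ≼ w)) → ⟦ p ⟧ ℚ.* (⟦ q ⟧ ℚ.* m v) ≡ 0ℚ
    vanish v (yes u≼v) (yes v≼w) = contradiction (λ {x} p → v≼w {x} (u≼v {x} p)) u⋠w
    vanish v (yes _)   (no _)    = trans (ℚ.*-identityˡ _) (ℚ.*-zeroˡ (m v))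
    vanish v (no _)    q         = ℚ.*-zeroˡ (⟦ q ⟧ ℚ.* m v)
  go (yes u≼w) (yes u≈w) = trans (decompose u≼w) (cong₂ ℚ._+_
    (∑-≈ w m (λ v v≈w → cong (ℚ._/ 1) (μ-refl {u = u} {v} (≈-trans {u = u} {w} {v} u≈w (≈-sym {u = v} {w} v≈w)))))
    -- No term lies strictly below the top: u ≤ v ≤ w ≈ u forces v ≈ w by antisymmetry.
    (∑-zero (perms n) λ v → ⟦⟧*-no ((u ≼? v) ×-dec (v ≺? w))
      (λ (u≼v , v≼w , v≉w) → v≉w (≼-antisym {u = v} {w} v≼w
        λ {x} p → u≼v {x} (≈⇒≼ {u = w} {u} (≈-sym {u = u} {w} u≈w) {x} p)))
      (m v)))
  go (yes u≼w) (no u≉w) = begin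
    ∑ (perms n) (λ v → ⟦ u ≼? v ⟧ ℚ.* (⟦ v ≼? w ⟧ ℚ.* m v))     ≡⟨ decompose u≼w ⟩
    ∑ (perms n) (λ v → ⟦ v ≈? w ⟧ ℚ.* m v) ℚ.+ below             ≡⟨ cong₂ ℚ._+_ top rest ⟩
    μ u w ℚ./ 1 ℚ.+ S ℚ./ 1                                      ≡⟨ /1-+ (μ u w) S ⟨
    (μ u w ℤ.+ S) ℚ./ 1                                          ≡⟨ cong (λ i → (i ℤ.+ S) ℚ./ 1) (μ-≺ {u = u} {w} u≺w) ⟩
    (ℤ.- S ℤ.+ S) ℚ./ 1                                          ≡⟨ cong (ℚ._/ 1) (ℤ.+-inverseˡ S) ⟩
    0ℚ                                                           ∎
    where
    u≺w : u ≺ w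
    u≺w = (λ {x} → u≼w {x}) , u≉w

    ws : List (Permutation′ n)
    ws = filter (λ v → (u ≼? v) ×-dec (v ≺? w)) (perms n)

    S : ℤ
    S = sumℤ (map (μ u) ws)

    top : ∑ (perms n) (λ v → ⟦ v ≈? w ⟧ ℚ.* m v) ≡ μ u w ℚ./ 1
    top = ∑-≈ w m λ v v≈w → cong (ℚ._/ 1)
      (sym (μ-congʳ {u = u} {w} {v} u≺w (≈-sym {u = v} {w} v≈w)))

    rest : below ≡ S ℚ./ 1
    rest = trans (sym (∑-filter (λ v → (u ≼? v) ×-dec (v ≺? w)) (perms n) m)) (sym (sumℤ-/1 ws (μ u)))

-- The permutations ζ_K

-- `insert zero j π` takes the value `punchIn j (π ⟨$⟩ʳ i)` at `suc i`, so comparing values of ζ_K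
-- comes down to how `punchIn` acts on order.
punchIn-below : ∀ (j : Fin (suc n)) x → toℕ x < toℕ j → toℕ (punchIn j x) ≡ toℕ x
punchIn-below (suc j) zero    lt       = refl
punchIn-below (suc j) (suc x) (s≤s lt) = cong suc (punchIn-below j x lt)

punchIn-above : ∀ (j : Fin (suc n)) x → toℕ j ≤ toℕ x → toℕ (punchIn j x) ≡ suc (toℕ x)
punchIn-above zero    x       le       = refl
punchIn-above (suc j) (suc x) (s≤s le) = cong suc (punchIn-above j x le)

punchIn-fromℕ : ∀ (x : Fin n) → toℕ (punchIn (fromℕ n) x) ≡ toℕ x
punchIn-fromℕ {n} x = punchIn-below (fromℕ n) x (subst (toℕ x <_) (sym (Fin.toℕ-fromℕ n)) (Fin.toℕ<n x))

-- When `a` is the old first value, `punchIn` moves it to a + 1 and a becomes the new first value.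
-- The new first entry thus lies above the same later entries as the old one.
punchIn-inject₁-<⁺ : ∀ {a x : Fin n} → x Fin.< a → punchIn (inject₁ a) x Fin.< inject₁ a
punchIn-inject₁-<⁺ {a = a} {x} x<a = subst (_< toℕ (inject₁ a)) (sym (punchIn-below (inject₁ a) x x<a′)) x<a′
  where
  x<a′ : toℕ x < toℕ (inject₁ a)
  x<a′ = subst (toℕ x <_) (sym (Fin.toℕ-inject₁ a)) x<a

punchIn-inject₁-<⁻ : ∀ {a x : Fin n} → punchIn (inject₁ a) x Fin.< inject₁ a → x Fin.< a
punchIn-inject₁-<⁻ {a = a} {x} lt = ℕ.≰⇒> λ a≤x →
  let a′≤x = subst (_≤ toℕ x) (sym (Fin.toℕ-inject₁ a)) a≤x in
  ℕ.<⇒≱ lt (subst (toℕ (inject₁ a) ≤_) (sym (punchIn-above (inject₁ a) x a′≤x)) (ℕ.m≤n⇒m≤1+n a′≤x))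

punchIn-mono-< : ∀ (j : Fin (suc n)) {x y} → x Fin.< y → punchIn j x Fin.< punchIn j y
punchIn-mono-< j {x} {y} x<y = ℕ.≰⇒> λ le → ℕ.<⇒≱ x<y (Fin.punchIn-cancel-≤ j y x le)

punchIn-cancel-< : ∀ (j : Fin (suc n)) {x y} → punchIn j x Fin.< punchIn j y → x Fin.< y
punchIn-cancel-< j {x} {y} lt = ℕ.≰⇒> λ y≤x → ℕ.<⇒≱ lt (Fin.punchIn-mono-≤ j y x y≤x)

-- The first value of ζ_K is the largest one if 1 ∈ K, and otherwise it is
-- the predecessor of the second value.
ζperm : Subset n → Permutation′ (suc n)
ζperm []            = Perm.id
ζperm (inside ∷ K)  = insert zero (fromℕ _) (ζperm K)
ζperm (outside ∷ K) = insert zero (inject₁ (ζperm K ⟨$⟩ʳ zero)) (ζperm K)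

-- The position p = k + 1 has the 0-based index `inject₁ k`. For i < j the condition means that i
-- and j lie in different blocks of ζ_K.
Separated : Subset n → Fin (suc n) → Fin (suc n) → Set
Separated K i j = ∃ λ k → k ∈ K × i Fin.≤ inject₁ k × inject₁ k Fin.< j

ζperm-tail : ∀ b (K : Subset n) → ∃ λ a → ∀ i → ζperm (b ∷ K) ⟨$⟩ʳ suc i ≡ punchIn a (ζperm K ⟨$⟩ʳ i)
ζperm-tail inside  K = _ , λ _ → refl
ζperm-tail outside K = _ , λ _ → refl

-- Induction removes the first position. If it belongs to K, its value is the maximum; otherwise it
-- is compared through the second position. Pairs of later positions keep their order under
-- `punchIn`.
Separated⇒ζperm-< : ∀ (K : Subset n) {i j} → Separated K i j → ζperm K ⟨$⟩ʳ j Fin.< ζperm K ⟨$⟩ʳ i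
Separated⇒ζperm-< (inside ∷ K) {zero} {suc j} _ = subst₂ _<_
  (sym (punchIn-fromℕ (ζperm K ⟨$⟩ʳ j))) (sym (Fin.toℕ-fromℕ _)) (Fin.toℕ<n _)
-- The first two positions share a block, so the same separator serves with the second position in
-- place of the first.
Separated⇒ζperm-< (outside ∷ K) {zero} {suc j} (suc k , there k∈K , _ , s≤s k<j) =
  punchIn-inject₁-<⁺ (Separated⇒ζperm-< K (k , k∈K , z≤n , k<j))
Separated⇒ζperm-< (b ∷ K) {suc i} {suc j} (suc k , there k∈K , s≤s i≤k , s≤s k<j)
  with a , eq ← ζperm-tail b K = subst₂ Fin._<_ (sym (eq j)) (sym (eq i))
    (punchIn-mono-< a (Separated⇒ζperm-< K (k , k∈K , i≤k , k<j)))

ζperm-<⇒Separated : ∀ (K : Subset n) {i j} → i Fin.< j → ζperm K ⟨$⟩ʳ j Fin.< ζperm K ⟨$⟩ʳ i → Separated K i j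
ζperm-<⇒Separated [] {zero} {zero} () _
ζperm-<⇒Separated (inside ∷ K) {zero} {suc j} _ _ = zero , here , z≤n , s≤s z≤n
-- Within the shared block, an inversion of the first two entries would put the old first value
-- below itself.
ζperm-<⇒Separated (outside ∷ K) {zero} {suc zero} _ lt =
  contradiction (punchIn-inject₁-<⁻ lt) (ℕ.<-irrefl refl)
ζperm-<⇒Separated (outside ∷ K) {zero} {suc (suc j)} _ lt
  with k , k∈K , _ , k<j ← ζperm-<⇒Separated K {zero} {suc j} (s≤s z≤n) (punchIn-inject₁-<⁻ lt) =
  suc k , there k∈K , z≤n , s≤s k<j
ζperm-<⇒Separated (b ∷ K) {suc i} {suc j} (s≤s i<j) lt
  with a , eq ← ζperm-tail b K
  with k , k∈K , i≤k , k<j ← ζperm-<⇒Separated K i<j (punchIn-cancel-< a (subst₂ Fin._<_ (eq j) (eq i) lt)) =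
  suc k , there k∈K , s≤s i≤k , s≤s k<j

-- Descent sets and the permutations below ζ_K

inject₁<suc : (k : Fin n) → inject₁ k Fin.< suc k
inject₁<suc k = s≤s (ℕ.≤-reflexive (Fin.toℕ-inject₁ k))

-- A separator `l` satisfies k ≤ l ≤ k.
Separated-adjacent : ∀ {K : Subset n} {k} → Separated K (inject₁ k) (suc k) → k ∈ K
Separated-adjacent {k = k} (l , l∈K , k≤l , s≤s l≤k) = subst (_∈ _) (Fin.toℕ-injective (ℕ.≤-antisym
  (subst (_≤ toℕ k) (Fin.toℕ-inject₁ l) l≤k)
  (subst₂ _≤_ (Fin.toℕ-inject₁ k) (Fin.toℕ-inject₁ l) k≤l))) l∈K

module _ {P : Fin n → Set} (P? : U.Decidable P) where

  ∈-tabulate-does⁺ : ∀ {k} → P k → k ∈ Vec.tabulate (does ∘ P?)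
  ∈-tabulate-does⁺ {k} p = Vec.lookup⇒[]= k _ (trans (Vec.lookup∘tabulate _ k) (dec-true (P? k) p))

  ∈-tabulate-does⁻ : ∀ {k} → k ∈ Vec.tabulate (does ∘ P?) → P k
  ∈-tabulate-does⁻ {k} k∈ with P? k | trans (sym (Vec.lookup∘tabulate (does ∘ P?) k)) (Vec.[]=⇒lookup k∈)
  ... | yes p | _ = p
  ... | no _  | ()

-- Entries that end lower than they began must drop at some step; induction on `j` finds the last
-- drop.
descent-between : (v : Permutation′ (suc n)) → ∀ j {i} → i Fin.< j → v ⟨$⟩ʳ j Fin.< v ⟨$⟩ʳ i →
                  ∃ λ k → IsDescent v k × i Fin.≤ inject₁ k × inject₁ k Fin.< j
descent-between {n} v = <-weakInduction _ (λ ()) step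
  where
  step : ∀ j → (∀ {i} → i Fin.< inject₁ j → v ⟨$⟩ʳ inject₁ j Fin.< v ⟨$⟩ʳ i →
                ∃ λ k → IsDescent v k × i Fin.≤ inject₁ k × inject₁ k Fin.< inject₁ j) →
         ∀ {i} → i Fin.< suc j → v ⟨$⟩ʳ suc j Fin.< v ⟨$⟩ʳ i →
         ∃ λ k → IsDescent v k × i Fin.≤ inject₁ k × inject₁ k Fin.< suc j
  step j ih {i} (s≤s i≤j) lt with isDescent? v j
  ... | yes d = j , d , subst (toℕ i ≤_) (sym (Fin.toℕ-inject₁ j)) i≤j , inject₁<suc j
  -- Without a descent at `j`, the value at `inject₁ j` is at most that at `suc j`, hence below that
  -- at `i`. So `i` and `inject₁ j` still form an inversion, and strictness rules out i =
  -- `inject₁ j`.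
  ... | no ¬d with v[j]<v[i] ← ℕ.≤-<-trans (ℕ.≮⇒≥ ¬d) lt
    with k , d , i≤k , k<j ← ih
      (ℕ.≤∧≢⇒< (subst (toℕ i ≤_) (sym (Fin.toℕ-inject₁ j)) i≤j)
        (λ e → ℕ.<-irrefl (cong (λ x → toℕ (v ⟨$⟩ʳ x)) (sym (Fin.toℕ-injective e))) v[j]<v[i]))
      v[j]<v[i] = k , d , i≤k , ℕ.<-trans k<j (inject₁<suc j)

-- Every inversion of `v` spans a descent; as an element of K, that descent separates the pair.
Des⊆⇒≼ζperm : (v : Permutation′ (suc n)) (K : Subset n) → Des v ⊆ K → v ≼ ζperm K
Des⊆⇒≼ζperm v K Des⊆K {i , j} (i<j , lt) with k , d , i≤k , k<j ← descent-between v j i<j lt =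
  i<j , Separated⇒ζperm-< K (k , Des⊆K (∈-tabulate-does⁺ (isDescent? v) d) , i≤k , k<j)

-- A descent is an inversion of adjacent positions, which only the descent itself can separate.
≼ζperm⇒Des⊆ : (v : Permutation′ (suc n)) (K : Subset n) → v ≼ ζperm K → Des v ⊆ K
≼ζperm⇒Des⊆ v K v≼ζ {k} k∈Des = Separated-adjacent (ζperm-<⇒Separated K (inject₁<suc k)
  (proj₂ (v≼ζ (inject₁<suc k , ∈-tabulate-does⁻ (isDescent? v) k∈Des))))

-- A global descent inverts its two adjacent positions; conversely k in K separates every pair
-- across k. In particular ζ_K determines K.
GDes-ζperm : (u : Permutation′ (suc n)) (K : Subset n) → u Perm.≈ ζperm K → GDes u ≡ K
GDes-ζperm u K u≈ζ = ⊆-antisym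
  (λ {k} k∈ → Separated-adjacent (ζperm-<⇒Separated K (inject₁<suc k)
    (subst₂ Fin._<_ (u≈ζ (suc k)) (u≈ζ (inject₁ k))
      (∈-tabulate-does⁻ (isGlobalDescent? u) k∈ (inject₁ k) (suc k) ℕ.≤-refl (inject₁<suc k)))))
  (λ {k} k∈K → ∈-tabulate-does⁺ (isGlobalDescent? u) λ i j i≤k k<j →
    subst₂ Fin._<_ (sym (u≈ζ j)) (sym (u≈ζ i)) (Separated⇒ζperm-< K (k , k∈K , i≤k , k<j)))

-- One-line notation

-- `punchIn` on the 1-based entries of one-line notation.
punch : ℕ → ℕ → ℕ
punch h x = if does (x ℕ.<? h) then x else suc x

punch-< : ∀ {h x} → x < h → punch h x ≡ x
punch-< {h} {x} x<h rewrite dec-true (x ℕ.<? h) x<h = refl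

punch-≥ : ∀ {h x} → h ≤ x → punch h x ≡ suc x
punch-≥ {h} {x} h≤x rewrite dec-false (x ℕ.<? h) (ℕ.≤⇒≯ h≤x) = refl

toℕ-punchIn : ∀ (j : Fin (suc n)) x → suc (toℕ (punchIn j x)) ≡ punch (suc (toℕ j)) (suc (toℕ x))
toℕ-punchIn j x with toℕ x ℕ.<? toℕ j
... | yes x<j = trans (cong suc (punchIn-below j x x<j)) (sym (punch-< (s≤s x<j)))
... | no x≮j  = trans (cong suc (punchIn-above j x (ℕ.≮⇒≥ x≮j))) (sym (punch-≥ (s≤s (ℕ.≮⇒≥ x≮j))))

oneLine-insert-inject₁ : (a : Fin n) (π : Permutation′ n) →
  oneLine (insert zero (inject₁ a) π) ≡ suc (toℕ a) ∷ map (punch (suc (toℕ a))) (oneLine π)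
oneLine-insert-inject₁ a π = cong₂ _∷_ (cong suc (Fin.toℕ-inject₁ a)) (trans
  (List.tabulate-cong λ i → trans (toℕ-punchIn (inject₁ a) (π ⟨$⟩ʳ i))
    (cong (λ h → punch (suc h) (suc (toℕ (π ⟨$⟩ʳ i)))) (Fin.toℕ-inject₁ a)))
  (sym (List.map-tabulate (λ i → suc (toℕ (π ⟨$⟩ʳ i))) (punch (suc (toℕ a))))))

oneLine-insert-fromℕ : (π : Permutation′ n) → oneLine (insert zero (fromℕ n) π) ≡ suc n ∷ oneLine π
oneLine-insert-fromℕ {n} π = cong₂ _∷_ (cong suc (Fin.toℕ-fromℕ n))
  (List.tabulate-cong λ i → cong suc (punchIn-fromℕ (π ⟨$⟩ʳ i)))

[⋯]-≥ : ∀ a b → All (a ≤_) [ a ⋯ b ]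
[⋯]-≥ a b = All.map⁺ (All.universal (ℕ.m≤m+n a) (upTo (suc b ∸ a)))

[⋯]-≤ : ∀ a b → All (_≤ b) [ a ⋯ b ]
[⋯]-≤ a b = All.map⁺ (All.map bound (All.all-upTo (suc b ∸ a)))
  where
  bound : ∀ {i} → i < suc b ∸ a → a ℕ.+ i ≤ b
  bound {i} lt with a ℕ.≤? suc b
  ... | yes a≤ = subst (_≤ b) (ℕ.+-comm i a) (ℕ.≤-pred (ℕ.m≤o∸n⇒m+n≤o (suc i) a≤ lt))
  -- For a > b + 1 truncated subtraction gives length 0, so no index `i` exists.
  ... | no a≰  = contradiction (subst (i <_) (ℕ.m≤n⇒m∸n≡0 (ℕ.<⇒≤ (ℕ.≰⇒> a≰))) lt) λ ()

[⋯]-suc : ∀ a b → a ≤ suc b → [ a ⋯ suc b ] ≡ a ∷ map suc [ a ⋯ b ]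
[⋯]-suc a b a≤ = begin
  map (a ℕ.+_) (upTo (suc (suc b) ∸ a))               ≡⟨ cong (map (a ℕ.+_) ∘ upTo) (ℕ.+-∸-assoc 1 a≤) ⟩
  a ℕ.+ 0 ∷ map (a ℕ.+_) (List.applyUpTo suc k)       ≡⟨ cong₂ (λ x xs → x ∷ map (a ℕ.+_) xs) (ℕ.+-identityʳ a) (sym (List.map-upTo suc k)) ⟩
  a ∷ map (a ℕ.+_) (map suc (upTo k))                 ≡⟨ cong (a ∷_) (List.map-∘ (upTo k)) ⟨
  a ∷ map (λ i → a ℕ.+ suc i) (upTo k)                ≡⟨ cong (a ∷_) (List.map-cong (ℕ.+-suc a) (upTo k)) ⟩
  a ∷ map (λ i → suc (a ℕ.+ i)) (upTo k)              ≡⟨ cong (a ∷_) (List.map-∘ (upTo k)) ⟩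
  a ∷ map suc [ a ⋯ b ]                               ∎
  where
  open ≡-Reasoning
  k = suc b ∸ a

-- Comparing heads gives h = a. Entries of the first block are at least a and move up by one, later
-- entries are below a and stay, so prepending a lengthens the first block by one.
punch-[⋯]-++ : ∀ {a b xs h t} → a ≤ suc b → All (_< a) xs → h ∷ t ≡ [ a ⋯ suc b ] ++ xs →
               h ∷ map (punch h) ([ a ⋯ suc b ] ++ xs) ≡ [ a ⋯ suc (suc b) ] ++ xs
punch-[⋯]-++ {a} {b} {xs} {h} a≤ xs<a eq
  with refl ← List.∷-injectiveˡ (trans eq (cong (_++ xs) ([⋯]-suc a b a≤))) = begin
  a ∷ map (punch a) ([ a ⋯ suc b ] ++ xs)                   ≡⟨ cong (a ∷_) (List.map-++ (punch a) [ a ⋯ suc b ] xs) ⟩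
  a ∷ map (punch a) [ a ⋯ suc b ] ++ map (punch a) xs       ≡⟨ cong₂ (λ ys zs → a ∷ ys ++ zs)
                                                                 (List.map-cong-local (All.map punch-≥ ([⋯]-≥ a (suc b))))
                                                                 (List.map-id-local (All.map punch-< xs<a)) ⟩
  a ∷ map suc [ a ⋯ suc b ] ++ xs                           ≡⟨ cong (_++ xs) ([⋯]-suc a (suc b) (ℕ.m≤n⇒m≤1+n a≤)) ⟨
  [ a ⋯ suc (suc b) ] ++ xs                                 ∎
  where open ≡-Reasoning

-- Only the differences n - p enter the blocks.
blocks-suc : ∀ m q ps → blocks (suc m) (suc q) (map suc ps) ≡ blocks m q ps
blocks-suc m q []       = refl
blocks-suc m q (p ∷ ps) = cong ([ m ∸ p ℕ.+ 1 ⋯ m ∸ q ] ++_) (blocks-suc m p ps)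

blocks-≤ : ∀ m q ps → AllPairs _<_ (q ∷ ps) → All (_≤ m ∸ q) (blocks m q ps)
blocks-≤ m q []       _                  = [⋯]-≤ 1 (m ∸ q)
blocks-≤ m q (p ∷ ps) ((q<p ∷ _) ∷ inc) = All.++⁺ ([⋯]-≤ (m ∸ p ℕ.+ 1) (m ∸ q))
  (All.map (λ x≤ → ℕ.≤-trans x≤ (ℕ.∸-monoʳ-≤ m (ℕ.<⇒≤ q<p))) (blocks-≤ m p ps inc))

-- The recursion of ζ_K for 1 ∉ K: the first block grows by one and all cut points move up by one.
punch-blocks : ∀ m ps {h t} → AllPairs _<_ (0 ∷ ps) → h ∷ t ≡ blocks (suc m) 0 ps →
               h ∷ map (punch h) (blocks (suc m) 0 ps) ≡ blocks (suc (suc m)) 0 (map suc ps)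
punch-blocks m [] {h} {t} _ eq = begin
  h ∷ map (punch h) [ 1 ⋯ suc m ]            ≡⟨ cong (λ xs → h ∷ map (punch h) xs) (List.++-identityʳ _) ⟨
  h ∷ map (punch h) ([ 1 ⋯ suc m ] ++ [])    ≡⟨ punch-[⋯]-++ {1} {m} (s≤s z≤n) [] (trans eq (sym (List.++-identityʳ _))) ⟩
  [ 1 ⋯ suc (suc m) ] ++ []                  ≡⟨ List.++-identityʳ _ ⟩
  [ 1 ⋯ suc (suc m) ]                        ∎
  where open ≡-Reasoning
punch-blocks m (suc p ∷ ps) (_ ∷ inc) eq = trans
  (punch-[⋯]-++ {m ∸ p ℕ.+ 1} {m} (subst (_≤ suc m) (ℕ.+-comm 1 (m ∸ p)) (s≤s (ℕ.m∸n≤m m p)))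
    (All.map (λ {x} x≤ → subst (x <_) (ℕ.+-comm 1 (m ∸ p)) (s≤s x≤)) (blocks-≤ (suc m) (suc p) ps inc)) eq)
  (cong ([ m ∸ p ℕ.+ 1 ⋯ suc (suc m) ] ++_) (sym (blocks-suc (suc m) (suc p) ps)))
punch-blocks m (zero ∷ ps) ((() ∷ _) ∷ _) eq

elements-increasing : (K : Subset n) → AllPairs _<_ (0 ∷ elements K)
elements-increasing {n} K =
  All.map⁺ (All.universal (λ _ → s≤s z≤n) (filter (_∈? K) (List.allFin n))) ∷
  AllPairs.map⁺ (AllPairs.filter⁺ (_∈? K) (AllPairs.tabulate⁺-< s≤s))

-- An arbitrary `f` lets the induction follow `tabulate`; the identity is the case used.
elements-tail : ∀ b (K : Subset n) {m} (f : Fin m → Fin n) →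
  map (ℕ.suc ∘ toℕ) (filter (_∈? (b ∷ K)) (tabulate (suc ∘ f))) ≡
  map ℕ.suc (map (ℕ.suc ∘ toℕ) (filter (_∈? K) (tabulate f)))
elements-tail b K {zero}  f = refl
elements-tail b K {suc m} f with f zero ∈? K
... | yes _ = cong (_ ∷_) (elements-tail b K (f ∘ suc))
... | no _  = elements-tail b K (f ∘ suc)

-- Both descriptions satisfy the same recursion on K: a new singleton block in front if 1 ∈ K, a
-- longer first block otherwise.
oneLine-ζperm : (K : Subset n) → oneLine (ζperm K) ≡ ζ (suc n) K
oneLine-ζperm [] = refl
oneLine-ζperm {suc n} (inside ∷ K) = begin
  oneLine (ζperm (inside ∷ K))                                     ≡⟨ oneLine-insert-fromℕ (ζperm K) ⟩
  suc (suc n) ∷ oneLine (ζperm K)                                  ≡⟨ cong (suc (suc n) ∷_) (oneLine-ζperm K) ⟩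
  suc (suc n) ∷ blocks (suc n) 0 (elements K)                      ≡⟨ cong (suc (suc n) ∷_) (blocks-suc (suc n) 0 (elements K)) ⟨
  suc (suc n) ∷ blocks (suc (suc n)) 1 (map suc (elements K))      ≡⟨ cong₂ (λ xs ps → xs ++ blocks (suc (suc n)) 1 ps) top (elements-tail inside K (λ i → i)) ⟨
  ζ (suc (suc n)) (inside ∷ K)                                     ∎
  where
  open ≡-Reasoning
  -- For p = 1 the first block runs from (n + 2) - 1 + 1 to n + 2.
  top : [ suc n ℕ.+ 1 ⋯ suc (suc n) ] ≡ suc (suc n) ∷ []
  top rewrite ℕ.+-comm n 1 | ℕ.m+n∸n≡m 1 n | ℕ.+-identityʳ n = refl
oneLine-ζperm {suc n} (outside ∷ K) = begin
  oneLine (ζperm (outside ∷ K))                                    ≡⟨ oneLine-insert-inject₁ (ζperm K ⟨$⟩ʳ zero) (ζperm K) ⟩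
  h ∷ map (punch h) (oneLine (ζperm K))                            ≡⟨ cong (λ xs → h ∷ map (punch h) xs) (oneLine-ζperm K) ⟩
  h ∷ map (punch h) (blocks (suc n) 0 (elements K))                ≡⟨ punch-blocks n (elements K) (elements-increasing K) (oneLine-ζperm K) ⟩
  blocks (suc (suc n)) 0 (map suc (elements K))                    ≡⟨ cong (blocks (suc (suc n)) 0) (elements-tail outside K (λ i → i)) ⟨
  ζ (suc (suc n)) (outside ∷ K)                                    ∎
  where
  open ≡-Reasoning
  h = suc (toℕ (ζperm K ⟨$⟩ʳ zero))

-- Closed permutations as the ζ_K

tabulate-injective : {f g : Fin n → A} → tabulate f ≡ tabulate g → ∀ i → f i ≡ g i
tabulate-injective eq zero    = List.∷-injectiveˡ eq
tabulate-injective eq (suc i) = tabulate-injective (List.∷-injectiveʳ eq) i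

Closed⇒≈ζperm : (u : Permutation′ (suc n)) → Closed u → ∃ λ K → u Perm.≈ ζperm K
Closed⇒≈ζperm u (K , eq) = K , λ i →
  Fin.toℕ-injective (ℕ.suc-injective (tabulate-injective
    {f = λ i → suc (toℕ (u ⟨$⟩ʳ i))} {g = λ i → suc (toℕ (ζperm K ⟨$⟩ʳ i))} (trans eq (sym (oneLine-ζperm K))) i))

≈ζperm⇒Closed : (u : Permutation′ (suc n)) (K : Subset n) → u Perm.≈ ζperm K → Closed u
≈ζperm⇒Closed u K u≈ζ = K , trans (List.tabulate-cong λ i → cong (suc ∘ toℕ) (u≈ζ i)) (oneLine-ζperm K)

-- Expansion of 𝒟 (ℳ u) in the monomial basis

subsets-complete : (K : Subset n) → K ∈ₗ subsets n
subsets-complete []            = here refl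
subsets-complete (outside ∷ K) = ∈ₗ.∈-++⁺ˡ (∈ₗ.∈-map⁺ (outside ∷_) (subsets-complete K))
subsets-complete (inside ∷ K)  = ∈ₗ.∈-++⁺ʳ _ (∈ₗ.∈-map⁺ (inside ∷_) (subsets-complete K))

subsets-unique : ∀ n → Unique (subsets n)
subsets-unique zero    = [] ∷ []
subsets-unique (suc n) = Unique.++⁺
  (Unique.map⁺ Vec.∷-injectiveʳ (subsets-unique n))
  (Unique.map⁺ Vec.∷-injectiveʳ (subsets-unique n))
  disjoint
  where
  disjoint : ∀ {K} → ¬ (K ∈ₗ map (outside ∷_) (subsets n) × K ∈ₗ map (inside ∷_) (subsets n))
  disjoint (p , q) with _ , _ , refl ← ∈ₗ.∈-map⁻ (outside ∷_) p with _ , _ , () ← ∈ₗ.∈-map⁻ (inside ∷_) q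

coeff-sumQ : ∀ (g : A → QSym) xs s → coeff (sumQ (map g xs)) s ≡ ∑ xs (λ x → coeff (g x) s)
coeff-sumQ g []       s = refl
coeff-sumQ g (x ∷ xs) s = cong (coeff (g x) s ℚ.+_) (coeff-sumQ g xs s)

coeff-𝒟-sumˢ : ∀ (q : Permutation′ n → ℚ) vs s →
  coeff (𝒟 (sumˢ (map (λ v → q v ·ˢ 𝓕 v) vs))) s ≡ ∑ vs (λ v → q v ℚ.* coeff (F n (Des v)) s)
coeff-𝒟-sumˢ         q []       s = refl
coeff-𝒟-sumˢ {n = n} q (v ∷ vs) s = cong₂ ℚ._+_
  (cong (ℚ._* coeff (F n (Des v)) s) (ℚ.*-identityʳ (q v))) (coeff-𝒟-sumˢ q vs s)

coeff-F : ∀ n J s → coeff (F n J) s ≡ ∑ (subsets (ℕ.pred n)) (λ K → ⟦ J ⊆? K ⟧ ℚ.* coeff (M n K) s)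
coeff-F n J s = trans (coeff-sumQ (M n) (filter (J ⊆?_) (subsets (ℕ.pred n))) s)
  (∑-filter (J ⊆?_) (subsets (ℕ.pred n)) (λ K → coeff (M n K) s))

*-rearrange : ∀ a b c d → a ℚ.* (b ℚ.* (c ℚ.* d)) ≡ d ℚ.* (a ℚ.* (c ℚ.* b))
*-rearrange a b c d = begin
  a ℚ.* (b ℚ.* (c ℚ.* d))  ≡⟨ cong (a ℚ.*_) (ℚ.*-assoc b c d) ⟨
  a ℚ.* ((b ℚ.* c) ℚ.* d)  ≡⟨ cong (λ x → a ℚ.* (x ℚ.* d)) (ℚ.*-comm b c) ⟩
  a ℚ.* ((c ℚ.* b) ℚ.* d)  ≡⟨ ℚ.*-assoc a (c ℚ.* b) d ⟨
  (a ℚ.* (c ℚ.* b)) ℚ.* d  ≡⟨ ℚ.*-comm (a ℚ.* (c ℚ.* b)) d ⟩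
  d ℚ.* (a ℚ.* (c ℚ.* b))  ∎
  where open ≡-Reasoning

-- Expanding each F_{Des(v)} into the M_K and exchanging the sums leaves, at each M_K, an interval
-- sum of the Möbius function.
coeff-𝒟-ℳ : (u : Permutation′ (suc n)) → ∀ s →
  coeff (𝒟 (ℳ u)) s ≡ ∑ (subsets n) (λ K → ⟦ u ≈? ζperm K ⟧ ℚ.* coeff (M (suc n) K) s)
coeff-𝒟-ℳ {n} u s = begin
  coeff (𝒟 (ℳ u)) s
    ≡⟨ coeff-𝒟-sumˢ m (filter (u ≼?_) vs) s ⟩
  ∑ (filter (u ≼?_) vs) (λ v → m v ℚ.* coeff (F (suc n) (Des v)) s)
    ≡⟨ ∑-filter (u ≼?_) vs (λ v → m v ℚ.* coeff (F (suc n) (Des v)) s) ⟩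
  ∑ vs (λ v → ⟦ u ≼? v ⟧ ℚ.* (m v ℚ.* coeff (F (suc n) (Des v)) s))
    ≡⟨ ∑-cong vs expand ⟩
  ∑ vs (λ v → ∑ Ks (λ K → c K ℚ.* t K v))
    ≡⟨ ∑-swap vs Ks (λ v K → c K ℚ.* t K v) ⟩
  ∑ Ks (λ K → ∑ vs (λ v → c K ℚ.* t K v))
    ≡⟨ ∑-cong Ks (λ K → ∑-*ˡ vs (c K) (t K)) ⟩
  ∑ Ks (λ K → c K ℚ.* ∑ vs (t K))
    ≡⟨ ∑-cong Ks (λ K → trans (cong (c K ℚ.*_) (∑-μ-interval u (ζperm K))) (ℚ.*-comm (c K) _)) ⟩
  ∑ Ks (λ K → ⟦ u ≈? ζperm K ⟧ ℚ.* c K) ∎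
  where
  open ≡-Reasoning

  vs = perms (suc n)
  Ks = subsets n

  m : Permutation′ (suc n) → ℚ
  m v = μ u v ℚ./ 1

  c : Subset n → ℚ
  c K = coeff (M (suc n) K) s

  t : Subset n → Permutation′ (suc n) → ℚ
  t K v = ⟦ u ≼? v ⟧ ℚ.* (⟦ v ≼? ζperm K ⟧ ℚ.* m v)

  expand : ∀ v → ⟦ u ≼? v ⟧ ℚ.* (m v ℚ.* coeff (F (suc n) (Des v)) s) ≡ ∑ Ks (λ K → c K ℚ.* t K v)
  expand v = begin
    a ℚ.* (m v ℚ.* coeff (F (suc n) (Des v)) s)
      ≡⟨ cong (λ x → a ℚ.* (m v ℚ.* x)) (coeff-F (suc n) (Des v) s) ⟩
    a ℚ.* (m v ℚ.* ∑ Ks (λ K → ⟦ Des v ⊆? K ⟧ ℚ.* c K))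
      ≡⟨ cong (a ℚ.*_) (∑-*ˡ Ks (m v) _) ⟨
    a ℚ.* ∑ Ks (λ K → m v ℚ.* (⟦ Des v ⊆? K ⟧ ℚ.* c K))
      ≡⟨ ∑-*ˡ Ks a _ ⟨
    ∑ Ks (λ K → a ℚ.* (m v ℚ.* (⟦ Des v ⊆? K ⟧ ℚ.* c K)))
      -- Here the condition Des(v) ⊆ K becomes v ≤ ζ_K.
      ≡⟨ ∑-cong Ks (λ K → cong (λ x → a ℚ.* (m v ℚ.* (x ℚ.* c K)))
           (⟦⟧-cong (Des v ⊆? K) (v ≼? ζperm K)
             (λ p {x} → Des⊆⇒≼ζperm v K p {x}) (λ p {x} → ≼ζperm⇒Des⊆ v K p {x}))) ⟩
    ∑ Ks (λ K → a ℚ.* (m v ℚ.* (⟦ v ≼? ζperm K ⟧ ℚ.* c K)))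
      ≡⟨ ∑-cong Ks (λ K → *-rearrange a (m v) ⟦ v ≼? ζperm K ⟧ (c K)) ⟩
    ∑ Ks (λ K → c K ℚ.* t K v) ∎
    where a = ⟦ u ≼? v ⟧

mainTheorem13 : (n : ℕ) → 1 ≤ n → (u : Permutation′ n) →
    (Closed u → 𝒟 (ℳ u) ≈ M n (GDes u)) ×
    (¬ Closed u → 𝒟 (ℳ u) ≈ 𝟘)
mainTheorem13 (suc n) _ u = closed , notClosed
  where
  closed : Closed u → 𝒟 (ℳ u) ≈ M (suc n) (GDes u)
  closed cl s with J , u≈ζJ ← Closed⇒≈ζperm u cl = trans (coeff-𝒟-ℳ u s)
    (∑-single (λ K → u ≈? ζperm K) (λ K → coeff (M (suc n) K) s)
      -- K is recovered as the set of global descents of `u`, so at most one K contributes.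
      (AllPairs.map (λ {K} {L} K≢L u≈ζK u≈ζL → K≢L (trans (sym (GDes-ζperm u K u≈ζK)) (GDes-ζperm u L u≈ζL)))
        (subsets-unique n))
      (Any.map (λ { refl → u≈ζJ }) (subsets-complete J))
      (λ K u≈ζK → cong (λ L → coeff (M (suc n) L) s) (sym (GDes-ζperm u K u≈ζK))))

  notClosed : ¬ Closed u → 𝒟 (ℳ u) ≈ 𝟘
  notClosed ¬cl s = trans (coeff-𝒟-ℳ u s)
    (∑-zero (subsets n) λ K → ⟦⟧*-no (u ≈? ζperm K) (λ u≈ζK → ¬cl (≈ζperm⇒Closed u K u≈ζK)) _)
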